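{- Let $k \geq 17$ be an integer and let $\Sigma$ be an alphabet with $k$ letters. Then there is no extremal square-free word over $\Sigma$. That is, for every nonempty-or-empty finite square-free word $W$ over $\Sigma$, there exist words $W_1, W_2$ over $\Sigma$ with $W = W_1W_2$ and a letter $x \in \Sigma$ such that $W_1 x W_2$ is square-free.
   Context: A word is a finite sequence of letters over a finite alphabet; a factor of a word is a subword consisting of consecutive letters. A square is a nonempty word of the form $XX$. A word is square-free if it has no square as a factor. An extension of a finite word $W$ is a word $W_1 x W_2$ where $x$ is a single letter and $W_1, W_2$ are (possibly empty) words with $W = W_1W_2$. An extremal square-free word is a square-free word none of whose extensions is square-free. -}

module Defs where

open import Data.List using (List; []; _∷_; _++_)
open import Data.Product using (Σ; ∃; _×_; _,_)
open import Relation.Binary.PropositionalEquality using (_≡_; _≢_)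
open import Relation.Nullary using (¬_)

IsSquare : {A : Set} → List A → Set
IsSquare {A} S = Σ (List A) λ X → (X ≢ []) × (S ≡ X ++ X)

IsFactor : {A : Set} → List A → List A → Set
IsFactor {A} F W = Σ (List A) λ U → Σ (List A) λ V → W ≡ U ++ F ++ V

SquareFree : {A : Set} → List A → Set
SquareFree {A} W = ¬ (Σ (List A) λ F → IsFactor F W × IsSquare F)

IsExtension : {A : Set} → List A → List A → Set
IsExtension {A} E W =
  Σ (List A) λ W₁ → Σ (List A) λ W₂ → Σ A λ x →
    (W ≡ W₁ ++ W₂) × (E ≡ W₁ ++ x ∷ W₂)

Extremal : {A : Set} → List A → Set
Extremal {A} W = SquareFree W × ((E : List A) → IsExtension E W → ¬ SquareFree E)

{-# OPTIONS --safe #-}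
module Submission where

-- Suppose that every letter inserted into every gap g of a square-free word w of length n
-- creates a square.  Deleting the inserted letter x from the square leaves UVU·V or U·VUV in w,
-- with the gap at the dot.  The longer of U and V is repeated in w with a shift q at most twice
-- its length, except for U = V = [].  Square-freeness makes this repetition maximal on the side
-- of the gap, so gaps with the same q lie far apart; g, q and the shape of the square determine x.
-- Two repetitions with shifts q ≠ q′ cannot overlap in |q - q′| letters, since that would be a
-- square of period |q - q′|; hence gaps belonging to nearby shifts lie far apart.  Grouping the
-- shifts into intervals that grow geometrically, each interval with a minimal distance s
-- between its gaps, bounds the number of pairs (g , x) by a convergent sum of terms n / s,
-- which is at most 188n / 12 < 17(n + 1).

open import Defs
open import Data.Bool using (T)
open import Data.Empty using (⊥; ⊥-elim)
open import Data.Fin using (Fin; toℕ; fromℕ<; remQuot; combine)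
open import Data.Fin.Properties using (any?; injective⇒≤; combine-remQuot; toℕ-injective; toℕ≤pred[n])
  renaming (_≟_ to _≟ᶠ_)
open import Data.List using (List; []; _∷_; _++_; length; map; concatMap; upTo; take; drop)
open import Data.List.Membership.Propositional using (_∈_)
open import Data.List.Membership.Propositional.Properties
  using (∈-++⁺ˡ; ∈-++⁺ʳ; ∈-map⁺; ∈-upTo⁺; ∈-concatMap⁺)
open import Data.List.Membership.Setoid.Properties using (index-injective)
open import Data.List.Properties
  using (take++drop≡id; ++-assoc; length-++; length-drop; length-take; drop-drop; length-map; length-upTo; map-++)
open import Data.List.Relation.Unary.All as All using (All)
open import Data.List.Relation.Unary.All.Properties using (++⁺)
open import Data.List.Relation.Unary.Any as Any using (here; there; index)
open import Data.Nat
open import Data.Nat.DivMod using (m/n*n≤m; m%n<n; m≡m%n+[m/n]*n; m/n≡1+[m∸n]/n; /-monoˡ-≤; n/1≡n)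
open import Data.Nat.ListAction using (sum)
open import Data.Nat.ListAction.Properties using (sum-++)
open import Data.Nat.Properties
open import Data.Nat.Tactic.RingSolver using (solve; solve-∀)
open import Data.Product using (Σ; ∃; ∃₂; _×_; _,_; proj₁; proj₂; map₁; map₂; uncurry)
open import Data.Sum using (_⊎_; inj₁; inj₂)
open import Relation.Binary.Definitions using (DecidableEquality; tri<; tri≈; tri>)
open import Relation.Binary.PropositionalEquality
open import Relation.Nullary using (¬_; Dec; yes; no)
open import Relation.Nullary.Decidable using (map′; _×-dec_; decidable-stable; ¬?)

private variable
  A : Set

-- Words as sequences

-- Reduces a linear inequality to a ring identity: `a ≤ b` collects the hypotheses and `k` is the
-- slack, so that only an equation is left to the ring solver.
≤-by : ∀ {a b m n} k → a ≤ b → b + m + k ≡ a + n → m ≤ n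
≤-by {a} {b} {m} {n} k a≤b eq = m+n≤o⇒m≤o m (+-cancelˡ-≤ a (m + k) n (begin
  a + (m + k) ≤⟨ +-monoˡ-≤ (m + k) a≤b ⟩
  b + (m + k) ≡⟨ +-assoc b m k ⟨
  b + m + k   ≡⟨ eq ⟩
  a + n       ∎))
  where open ≤-Reasoning

HasSquare : (ℕ → A) → ℕ → Set
HasSquare f n = ∃₂ λ a p → 0 < p × a + (p + p) ≤ n × (∀ {i} → i < p → f (a + i) ≡ f (a + p + i))

HasSquare-cong : ∀ {f f′ : ℕ → A} {n} → (∀ t → f t ≡ f′ t) → HasSquare f n → HasSquare f′ n
HasSquare-cong f≗f′ (a , p , 0<p , a+2p≤n , eq) =
  a , p , 0<p , a+2p≤n , λ i<p → trans (sym (f≗f′ _)) (trans (eq i<p) (f≗f′ _))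

-- Both `a` and `p` are at most `n`, so the search is finite. Decidability is what turns the failure
-- of every insertion into actual squares.
hasSquare? : DecidableEquality A → (f : ℕ → A) (n : ℕ) → Dec (HasSquare f n)
hasSquare? _≟ᴬ_ f n = map′ to from (anyUpTo? (λ a → anyUpTo? (squareAt? a) (suc n)) (suc n))
  where
  SquareAt : ℕ → ℕ → Set
  SquareAt a p = 0 < p × a + (p + p) ≤ n × (∀ {i} → i < p → f (a + i) ≡ f (a + p + i))

  squareAt? : ∀ a p → Dec (SquareAt a p)
  squareAt? a p = (0 <? p) ×-dec (a + (p + p) ≤? n)
    ×-dec allUpTo? (λ i → f (a + i) ≟ᴬ f (a + p + i)) p

  to : (∃ λ a → a < suc n × ∃ λ p → p < suc n × SquareAt a p) → HasSquare f n
  to (a , _ , p , _ , sq) = a , p , sq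

  from : HasSquare f n → ∃ λ a → a < suc n × ∃ λ p → p < suc n × SquareAt a p
  from (a , p , sq@(_ , bound , _)) =
    a , s≤s (m+n≤o⇒m≤o a bound) , p , s≤s (m+n≤o⇒m≤o p (m+n≤o⇒n≤o a bound)) , sq

-- The default letter d fills the positions beyond the end of the word.
at : A → List A → ℕ → A
at d []       _       = d
at d (x ∷ _)  zero    = x
at d (_ ∷ xs) (suc t) = at d xs t

at-++ʳ : ∀ (d : A) xs ys t → at d (xs ++ ys) (length xs + t) ≡ at d ys t
at-++ʳ d []       ys t = refl
at-++ʳ d (_ ∷ xs) ys t = at-++ʳ d xs ys t

at-++ˡ : ∀ (d : A) xs ys {t} → t < length xs → at d (xs ++ ys) t ≡ at d xs t
at-++ˡ d (_ ∷ xs) ys {zero}  _         = refl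
at-++ˡ d (_ ∷ xs) ys {suc t} (s≤s t<n) = at-++ˡ d xs ys t<n

at-drop : ∀ (d : A) a xs t → at d (drop a xs) t ≡ at d xs (a + t)
at-drop d zero    xs       t = refl
at-drop d (suc a) []       t = refl
at-drop d (suc a) (_ ∷ xs) t = at-drop d a xs t

take-cong : ∀ (d : A) p {xs ys} → p ≤ length xs → p ≤ length ys →
            (∀ {i} → i < p → at d xs i ≡ at d ys i) → take p xs ≡ take p ys
take-cong d zero    _         _         _  = refl
take-cong d (suc p) {_ ∷ _} {_ ∷ _} (s≤s p≤m) (s≤s p≤n) eq =
  cong₂ _∷_ (eq z<s) (take-cong d p p≤m p≤n λ i<p → eq (s<s i<p))

squareFree⇒¬hasSquare : ∀ (d : A) W → SquareFree W → ¬ HasSquare (at d W) (length W)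
squareFree⇒¬hasSquare d W sqf (a , p , 0<p , bound , eq) =
  sqf (X ++ X , (take a W , drop p R , factor) , X , X≢[] , refl)
  where
  open ≡-Reasoning
  L R X : List _
  L = drop a W
  R = drop p L
  X = take p L

  length-L : p + p ≤ length L
  length-L = subst (p + p ≤_) (sym (length-drop a W))
    (m+n≤o⇒m≤o∸n (p + p) (subst (_≤ length W) (+-comm a (p + p)) bound))

  length-R : p ≤ length R
  length-R = subst (p ≤_) (sym (length-drop p L)) (m+n≤o⇒m≤o∸n p length-L)

  p≤L : p ≤ length L
  p≤L = m+n≤o⇒m≤o p length-L

  X≡ : X ≡ take p R
  X≡ = take-cong d p p≤L length-R λ {i} i<p → begin
    at d L i                ≡⟨ at-drop d a W i ⟩
    at d W (a + i)          ≡⟨ eq i<p ⟩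
    at d W (a + p + i)      ≡⟨ at-drop d (a + p) W i ⟨
    at d (drop (a + p) W) i ≡⟨ cong (λ xs → at d xs i) (drop-drop a p W) ⟨
    at d R i                ∎

  X≢[] : X ≢ []
  X≢[] X≡[] = <⇒≢ 0<p (sym (begin
    p                   ≡⟨ m≤n⇒m⊓n≡m p≤L ⟨
    p ⊓ length L        ≡⟨ length-take p L ⟨
    length X            ≡⟨ cong length X≡[] ⟩
    0                   ∎))

  factor : W ≡ take a W ++ (X ++ X) ++ drop p R
  factor = begin
    W                                     ≡⟨ take++drop≡id a W ⟨
    take a W ++ L                         ≡⟨ cong (take a W ++_) (take++drop≡id p L) ⟨
    take a W ++ X ++ R                    ≡⟨ cong (λ Y → take a W ++ X ++ Y) (take++drop≡id p R) ⟨
    take a W ++ X ++ take p R ++ drop p R ≡⟨ cong (λ Y → take a W ++ X ++ Y ++ drop p R) X≡ ⟨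
    take a W ++ X ++ X ++ drop p R        ≡⟨ cong (take a W ++_) (++-assoc X X (drop p R)) ⟨
    take a W ++ (X ++ X) ++ drop p R      ∎

0<length : ∀ {X : List A} → X ≢ [] → 0 < length X
0<length {X = []}    X≢[] = ⊥-elim (X≢[] refl)
0<length {X = _ ∷ _} _    = z<s

¬hasSquare⇒squareFree : ∀ (d : A) W → ¬ HasSquare (at d W) (length W) → SquareFree W
¬hasSquare⇒squareFree d _ ¬sq (_ , (U , V , refl) , X , X≢[] , refl) =
  ¬sq (length U , length X , 0<length X≢[] , bound , eq)
  where
  open ≡-Reasoning
  rest : (X ++ X) ++ V ≡ X ++ X ++ V
  rest = ++-assoc X X V

  bound : length U + (length X + length X) ≤ length (U ++ (X ++ X) ++ V)
  bound = subst (length U + (length X + length X) ≤_) (sym (begin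
    length (U ++ (X ++ X) ++ V)                   ≡⟨ length-++ U ⟩
    length U + length ((X ++ X) ++ V)             ≡⟨ cong (length U +_) (length-++ (X ++ X)) ⟩
    length U + (length (X ++ X) + length V)       ≡⟨ cong (λ l → length U + (l + length V)) (length-++ X) ⟩
    length U + (length X + length X + length V)   ∎)) (+-monoʳ-≤ (length U) (m≤m+n _ _))

  eq : ∀ {i} → i < length X → at d (U ++ (X ++ X) ++ V) (length U + i) ≡
                              at d (U ++ (X ++ X) ++ V) (length U + length X + i)
  eq {i} i<p = begin
    at d (U ++ (X ++ X) ++ V) (length U + i)              ≡⟨ at-++ʳ d U _ i ⟩
    at d ((X ++ X) ++ V) i                                ≡⟨ cong (λ Y → at d Y i) rest ⟩
    at d (X ++ X ++ V) i                                  ≡⟨ at-++ˡ d X _ i<p ⟩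
    at d X i                                              ≡⟨ at-++ˡ d X V i<p ⟨
    at d (X ++ V) i                                       ≡⟨ at-++ʳ d X (X ++ V) i ⟨
    at d (X ++ X ++ V) (length X + i)                     ≡⟨ cong (λ Y → at d Y (length X + i)) rest ⟨
    at d ((X ++ X) ++ V) (length X + i)                   ≡⟨ at-++ʳ d U _ (length X + i) ⟨
    at d (U ++ (X ++ X) ++ V) (length U + (length X + i))
      ≡⟨ cong (at d (U ++ (X ++ X) ++ V)) (+-assoc (length U) (length X) i) ⟨
    at d (U ++ (X ++ X) ++ V) (length U + length X + i)   ∎

-- Inserting a letter at a gap

ins : ℕ → A → (ℕ → A) → ℕ → A
ins zero    x w zero    = x
ins zero    x w (suc t) = w t
ins (suc g) x w zero    = w 0
ins (suc g) x w (suc t) = ins g x (λ i → w (suc i)) t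

ins-< : ∀ {g t} (x : A) w → t < g → ins g x w t ≡ w t
ins-< {g = suc g} {zero}  x w _         = refl
ins-< {g = suc g} {suc t} x w (s≤s t<g) = ins-< x (λ i → w (suc i)) t<g

ins-≡ : ∀ g (x : A) w → ins g x w g ≡ x
ins-≡ zero    x w = refl
ins-≡ (suc g) x w = ins-≡ g x (λ i → w (suc i))

ins-> : ∀ {g t} (x : A) w → g ≤ t → ins g x w (suc t) ≡ w t
ins-> {g = zero}          x w _         = refl
ins-> {g = suc g} {suc t} x w (s≤s g≤t) = ins-> x (λ i → w (suc i)) g≤t

at-insert : ∀ (d : A) g x W t → g ≤ length W →
            ins g x (at d W) t ≡ at d (take g W ++ x ∷ drop g W) t
at-insert d zero    x W       zero    _         = refl
at-insert d zero    x W       (suc t) _         = refl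
at-insert d (suc g) x (_ ∷ W) zero    _         = refl
at-insert d (suc g) x (_ ∷ W) (suc t) (s≤s g≤n) = at-insert d g x W t g≤n

length-insert : ∀ g (x : A) W → length (take g W ++ x ∷ drop g W) ≡ suc (length W)
length-insert g x W = begin
  length (take g W ++ x ∷ drop g W)             ≡⟨ length-++ (take g W) ⟩
  length (take g W) + suc (length (drop g W))   ≡⟨ +-suc _ _ ⟩
  suc (length (take g W) + length (drop g W))   ≡⟨ cong suc (length-++ (take g W)) ⟨
  suc (length (take g W ++ drop g W))           ≡⟨ cong (λ Y → suc (length Y)) (take++drop≡id g W) ⟩
  suc (length W)                                ∎
  where open ≡-Reasoning

-- Repetitions

data Direction : Set where
  leftward rightward : Direction

data Side : Set where
  starting ending : Side

-- In the runs below, `t` lies in the copy that touches the gap, and the direction points to the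
-- other copy. The condition `q ≤ t` keeps the subtraction from being truncated.
Match : Direction → (ℕ → A) → ℕ → ℕ → ℕ → Set
Match leftward  w n q t = q ≤ t × t < n × w t ≡ w (t ∸ q)
Match rightward w n q t = t + q < n × w t ≡ w (t + q)

-- The partners of the `d` positions under the two shifts form two adjacent blocks of length `d`,
-- and both blocks repeat the letters from `y` on.
matches⇒square : ∀ dir {w : ℕ → A} {n} q {d} y → 0 < d →
                 (∀ {i} → i < d → Match dir w n q (y + i)) →
                 (∀ {i} → i < d → Match dir w n (q + d) (y + i)) → HasSquare w n
matches⇒square leftward {w} {n} q {d} y 0<d match match′
  with z , refl ← m≤n⇒∃[o]m+o≡n (subst (q + d ≤_) (+-identityʳ y) (proj₁ (match′ 0<d)))
  = z , d , 0<d , bound d 0<d (λ i<d → proj₁ (proj₂ (match i<d))) , λ {i} i<d → begin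
    w (z + i)                      ≡⟨ cong w (begin
        z + i                        ≡⟨ m+n∸m≡n (q + d) (z + i) ⟨
        q + d + (z + i) ∸ (q + d)    ≡⟨ cong (_∸ (q + d)) (+-assoc (q + d) z i) ⟨
        q + d + z + i ∸ (q + d)      ∎) ⟩
    w (q + d + z + i ∸ (q + d))    ≡⟨ proj₂ (proj₂ (match′ i<d)) ⟨
    w (q + d + z + i)              ≡⟨ proj₂ (proj₂ (match i<d)) ⟩
    w (q + d + z + i ∸ q)          ≡⟨ cong w (begin
        q + d + z + i ∸ q            ≡⟨ cong (_∸ q) (solve (q ∷ d ∷ z ∷ i ∷ [])) ⟩
        q + (z + d + i) ∸ q          ≡⟨ m+n∸m≡n q (z + d + i) ⟩
        z + d + i                    ∎) ⟩
    w (z + d + i)                  ∎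
  where
  open ≡-Reasoning
  bound : ∀ d → 0 < d → (∀ {i} → i < d → q + d + z + i < n) → z + (d + d) ≤ n
  bound (suc e) _ inside = ≤-by q (inside (n<1+n e)) (solve (q ∷ e ∷ z ∷ n ∷ []))
matches⇒square rightward {w} {n} q {d} y 0<d match match′ =
  y + q , d , 0<d , bound d 0<d (λ i<d → proj₁ (match′ i<d)) , λ {i} i<d → begin
    w (y + q + i)       ≡⟨ cong w (solve (y ∷ q ∷ i ∷ [])) ⟩
    w (y + i + q)       ≡⟨ proj₂ (match i<d) ⟨
    w (y + i)           ≡⟨ proj₂ (match′ i<d) ⟩
    w (y + i + (q + d)) ≡⟨ cong w (solve (y ∷ q ∷ i ∷ d ∷ [])) ⟩
    w (y + q + d + i)   ∎
  where
  open ≡-Reasoning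
  bound : ∀ d → 0 < d → (∀ {i} → i < d → y + i + (q + d) < n) → y + q + (d + d) ≤ n
  bound (suc e) _ inside = ≤-by 0 (inside (n<1+n e)) (solve (q ∷ e ∷ y ∷ n ∷ []))

-- A stretch of ℓ matches that starts or ends at the gap g and does not extend across it.
Run : Side → (ℕ → Set) → ℕ → ℕ → Set
Run starting M ℓ g = (∀ {i} → i < ℓ → M (g + i)) × (∀ {t} → suc t ≡ g → ¬ M t)
Run ending   M ℓ g = (∃ λ y → y + ℓ ≡ g × (∀ {i} → i < ℓ → M (y + i))) × ¬ M g

-- All that separating runs takes from square-freeness; the direction of the shift is thereby hidden
-- in `M`.
SparseMatches : (ℕ → ℕ → Set) → Set
SparseMatches M = ∀ q {d} y → 0 < d → (∀ {i} → i < d → M q (y + i)) →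
                  (∀ {i} → i < d → M (q + d) (y + i)) → ⊥

module _ {M : ℕ → ℕ → Set} (sparse : SparseMatches M) where

  -- The first two hypotheses say that the shifts differ by at most `e`. If they were distinct, as
  -- many of the `e` common positions as their difference would contradict sparsity.
  overlap⇒≡ : ∀ {q q′ y e} → q < q′ + suc e → q′ < q + suc e →
              (∀ {i} → i < e → M q (y + i)) → (∀ {i} → i < e → M q′ (y + i)) → q ≡ q′
  overlap⇒≡ {q} {q′} {y} {e} q<q′+e q′<q+e match match′ with <-cmp q q′
  ... | tri≈ _ q≡q′ _ = q≡q′
  ... | tri< q<q′ _ _ with d , refl ← m≤n⇒∃[o]m+o≡n q<q′ =
    ⊥-elim (sparse q {suc d} y z<s (λ i<d → match (<-≤-trans i<d d<e))
      (λ {i} i<d → subst (λ r → M r (y + i)) (sym (+-suc q d)) (match′ (<-≤-trans i<d d<e))))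
    where
    d<e : d < e
    d<e = ≤-by 0 q′<q+e (solve (q ∷ d ∷ e ∷ []))
  ... | tri> _ _ q′<q with d , refl ← m≤n⇒∃[o]m+o≡n q′<q =
    ⊥-elim (sparse q′ {suc d} y z<s (λ i<d → match′ (<-≤-trans i<d d<e))
      (λ {i} i<d → subst (λ r → M r (y + i)) (sym (+-suc q′ d)) (match (<-≤-trans i<d d<e))))
    where
    d<e : d < e
    d<e = ≤-by 0 q<q′+e (solve (q′ ∷ d ∷ e ∷ []))

  -- With k < s, the two runs share at least pred e positions, while their shifts differ by at
  -- most pred e.
  run-separation : ∀ side {s e q q′ ℓ ℓ′ g} k → Run side (M q) ℓ g → Run side (M q′) ℓ′ (g + k) →
                   s + e ≤ 2 + ℓ → s + e ≤ 2 + ℓ′ → q < q′ + e → q′ < q + e →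
                   k < s → k ≡ 0 × q ≡ q′
  run-separation _ {e = zero} {q} {q′} _ _ _ _ _ q<q′ q′<q _ =
    ⊥-elim (<-asym (subst (q <_) (+-identityʳ q′) q<q′) (subst (q′ <_) (+-identityʳ q) q′<q))
  run-separation starting {s} {suc e} {q} {q′} {ℓ} {ℓ′} {g} k (match , _) (match′ , maximal′)
                 s+e≤ℓ s+e≤ℓ′ q<q′+e q′<q+e k<s = k≡0 k maximal′ k<s , q≡q′
    where
    q≡q′ : q ≡ q′
    q≡q′ = overlap⇒≡ {e = e} q<q′+e q′<q+e
      (λ {i} i<e → subst (M q) (sym (+-assoc g k i)) (match {k + i}
        (≤-by 0 (+-mono-≤ (+-mono-≤ k<s i<e) s+e≤ℓ) (solve (k ∷ i ∷ s ∷ e ∷ ℓ ∷ [])))))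
      (λ i<e → match′ (≤-trans i<e
        (≤-by k (+-mono-≤ k<s s+e≤ℓ′) (solve (k ∷ s ∷ e ∷ ℓ′ ∷ [])))))

    -- Now that the shifts agree, the first run would cover the position just before a later gap
    -- `g + k`, where the second run must not be extendable.
    k≡0 : ∀ k → (∀ {t} → suc t ≡ g + k → ¬ M q′ t) → k < s → k ≡ 0
    k≡0 zero    _   _    = refl
    k≡0 (suc j) max j+1<s = ⊥-elim (max (sym (+-suc g j)) (subst (λ r → M r (g + j)) q≡q′
      (match {j} (≤-by e (+-mono-≤ j+1<s s+e≤ℓ) (solve (j ∷ s ∷ e ∷ ℓ ∷ []))))))
  run-separation ending {s} {suc e} {q} {q′} {ℓ} {ℓ′} k
                 ((y , refl , match) , maximal) ((y′ , y′+ℓ′≡g′ , match′) , _)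
                 s+e≤ℓ s+e≤ℓ′ q<q′+e q′<q+e k<s
    -- `r` and `r′` are the offsets in the two runs at which the last `e` positions before the first
    -- gap begin.
    with r , refl ← m≤n⇒∃[o]m+o≡n {e} {ℓ}
           (≤-by k (+-mono-≤ k<s s+e≤ℓ) (solve (k ∷ s ∷ e ∷ ℓ ∷ [])))
    with r′ , refl ← m≤n⇒∃[o]m+o≡n {e + k} {ℓ′}
           (≤-by 0 (+-mono-≤ k<s s+e≤ℓ′) (solve (k ∷ s ∷ e ∷ ℓ′ ∷ [])))
    = k≡0 k refl , q≡q′
    where
    open ≡-Reasoning
    y′+r′≡y+r : y′ + r′ ≡ y + r
    y′+r′≡y+r = +-cancelˡ-≡ (e + k) _ _ (begin
      e + k + (y′ + r′)   ≡⟨ solve (e ∷ k ∷ y′ ∷ r′ ∷ []) ⟩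
      y′ + (e + k + r′)   ≡⟨ y′+ℓ′≡g′ ⟩
      y + (e + r) + k     ≡⟨ solve (e ∷ k ∷ y ∷ r ∷ []) ⟩
      e + k + (y + r)     ∎)

    q≡q′ : q ≡ q′
    q≡q′ = overlap⇒≡ {y = y + r} {e = e} q<q′+e q′<q+e
      (λ {i} i<e → subst (M q) (sym (+-assoc y r i)) (match {r + i}
        (≤-by 0 i<e (solve (i ∷ e ∷ r ∷ [])))))
      (λ {i} i<e → subst (M q′) (trans (sym (+-assoc y′ r′ i)) (cong (_+ i) y′+r′≡y+r)) (match′ {r′ + i}
        (≤-by k i<e (solve (i ∷ e ∷ k ∷ r′ ∷ [])))))

    -- If the second gap were later, the second run, whose shift is the same, would still match at
    -- the first gap, where the first run stops.
    k≡0 : ∀ j → j ≡ k → k ≡ 0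
    k≡0 zero    refl = refl
    k≡0 (suc j) refl = ⊥-elim (maximal (subst₂ M (sym q≡q′) (begin
      y′ + (e + r′)   ≡⟨ solve (y′ ∷ e ∷ r′ ∷ []) ⟩
      e + (y′ + r′)   ≡⟨ cong (e +_) y′+r′≡y+r ⟩
      e + (y + r)     ≡⟨ solve (y ∷ e ∷ r ∷ []) ⟩
      y + (e + r)     ∎) (match′ {e + r′} (≤-by {0} {0} j z≤n (solve (e ∷ r′ ∷ j ∷ []))))))

-- Classes of shifts

-- The alternative q ≤ 1 accounts for a letter inserted next to an equal one, where U and V are
-- both empty.
Long : ℕ → ℕ → Set
Long q ℓ = q ≤ 1 ⊎ q ≤ ℓ + ℓ

-- The shifts q with lo ≤ q < lo + width; gaps of runs with such shifts are at least step apart.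
record Class : Set where
  constructor class
  field
    lo width step : ℕ
    .{{step≢0}}   : NonZero step

open Class

_∈ᶜ_ : ℕ → Class → Set
q ∈ᶜ c = lo c ≤ q × q < lo c + width c

-- The first condition leaves `step c` letters beyond the gap in the direction of the shift, which
-- bounds the number of blocks; the second is the length hypothesis of `run-separation`.
Sound : Class → Set
Sound c = step c ≤ lo c × (∀ {q ℓ} → q ∈ᶜ c → Long q ℓ → step c + width c ≤ 2 + ℓ)

-- A long run with shift at least `l ≥ 2` has `l ≤ 2 * ℓ`. The constant is 5 rather than 4 because
-- parity gives one extra unit when `s + b ≤ 2 + ℓ` is doubled.
sound : ∀ {l b s} .{{_ : NonZero s}} → 2 ≤ l → s ≤ l → 2 * (s + b) ≤ 5 + l → Sound (class l b s)
sound {l} {b} {s} 2≤l s≤l 2[s+b]≤5+l = s≤l , separated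
  where
  open ≤-Reasoning
  separated : ∀ {q ℓ} → q ∈ᶜ class l b s → Long q ℓ → s + b ≤ 2 + ℓ
  separated (l≤q , _) (inj₁ q≤1) = ⊥-elim (<⇒≱ (≤-trans 2≤l l≤q) q≤1)
  separated {q} {ℓ} (l≤q , _) (inj₂ q≤2ℓ) = s≤s⁻¹ (*-cancelˡ-< 2 (s + b) (3 + ℓ) (begin-strict
    2 * (s + b) ≤⟨ 2[s+b]≤5+l ⟩
    5 + l       ≤⟨ +-monoʳ-≤ 5 (≤-trans l≤q q≤2ℓ) ⟩
    5 + (ℓ + ℓ) <⟨ n<1+n _ ⟩
    6 + (ℓ + ℓ) ≡⟨ cong (6 +_) (cong (ℓ +_) (+-identityʳ ℓ)) ⟨
    6 + 2 * ℓ   ≡⟨ *-distribˡ-+ 2 3 ℓ ⟨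
    2 * (3 + ℓ) ∎))

Covers : ℕ → ℕ → List Class → Set
Covers l h cs = ∀ {q} → l ≤ q → q < h → ∃ λ c → c ∈ cs × q ∈ᶜ c

covers-[] : ∀ {l} → Covers l l []
covers-[] l≤q q<l = ⊥-elim (<⇒≱ q<l l≤q)

covers-∷ : ∀ {l b s h cs} .{{_ : NonZero s}} → Covers (l + b) h cs → Covers l h (class l b s ∷ cs)
covers-∷ {l} {b} cover {q} l≤q q<h with q <? l + b
... | yes q<l+b = _ , here refl , l≤q , q<l+b
... | no  q≮l+b = map₂ (map₁ there) (cover (≮⇒≥ q≮l+b) q<h)

covers-++ : ∀ {l m h cs ds} → Covers l m cs → Covers m h ds → Covers l h (cs ++ ds)
covers-++ {m = m} {cs = cs} cover cover′ {q} l≤q q<h with q <? m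
... | yes q<m = map₂ (map₁ ∈-++⁺ˡ) (cover l≤q q<m)
... | no  q≮m = map₂ (map₁ (∈-++⁺ʳ cs)) (cover′ (≮⇒≥ q≮m) q<h)

blocks : ℕ → List Class → ℕ
blocks n cs = sum (map (λ c → n / step c) cs)

blocks-++ : ∀ n cs ds → blocks n (cs ++ ds) ≡ blocks n cs + blocks n ds
blocks-++ n cs ds = trans (cong sum (map-++ _ cs ds)) (sum-++ (map _ cs) (map _ ds))

-- The shift 1 has a class of its own, since its run may be empty: step 1 and width 1 satisfy the
-- length hypothesis even for `ℓ = 0`.
unitClass : Class
unitClass = class 1 1 1

unitClass-sound : Sound unitClass
unitClass-sound = ≤-refl , λ _ _ → s≤s (s≤s z≤n)

-- Below 16 the additive 5 in `sound` matters, so the intervals are chosen one by one; each step is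
-- the largest that `sound` allows for its width.
smallClasses : List Class
smallClasses = class 2 1 2 ∷ class 3 2 2 ∷ class 5 2 3 ∷ class 7 2 4 ∷ class 9 3 4 ∷ class 12 4 4 ∷ []

smallClasses-sound : All Sound smallClasses
smallClasses-sound = check All.∷ check All.∷ check All.∷ check All.∷ check All.∷ check All.∷ All.[]
  where
  check : ∀ {l b s} .{{_ : NonZero s}} {_ : T (2 ≤ᵇ l)} {_ : T (s ≤ᵇ l)}
          {_ : T (2 * (s + b) ≤ᵇ 5 + l)} → Sound (class l b s)
  check {_} {_} {_} {2≤l} {s≤l} {bound} = sound (≤ᵇ⇒≤ _ _ 2≤l) (≤ᵇ⇒≤ _ _ s≤l) (≤ᵇ⇒≤ _ _ bound)

smallClasses-cover : Covers 2 16 smallClasses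
smallClasses-cover = covers-∷ (covers-∷ (covers-∷ (covers-∷ (covers-∷ (covers-∷ covers-[])))))

blocks-smallClasses : ∀ n → 12 * blocks n smallClasses ≤ 25 * n
blocks-smallClasses n = bound (n / 2) (n / 3) (n / 4) (m/n*n≤m n 2) (m/n*n≤m n 3) (m/n*n≤m n 4)
  where
  bound : ∀ x y z → x * 2 ≤ n → y * 3 ≤ n → z * 4 ≤ n →
          12 * (x + (x + (y + (z + (z + (z + 0)))))) ≤ 25 * n
  -- The reciprocals of the steps add up to 1/2 + 1/2 + 1/3 + 3/4; times 12 this gives the weights
  -- 12, 4 and 9.
  bound x y z x≤ y≤ z≤ = ≤-by 0
    (+-mono-≤ (*-monoʳ-≤ 12 x≤) (+-mono-≤ (*-monoʳ-≤ 4 y≤) (*-monoʳ-≤ 9 z≤)))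
    (identity n x y z)
    where
    identity : ∀ n x y z →
               12 * n + (4 * n + 9 * n) + 12 * (x + (x + (y + (z + (z + (z + 0)))))) + 0 ≡
               12 * (x * 2) + (4 * (y * 3) + 9 * (z * 4)) + 25 * n
    identity = solve-∀

-- Three intervals split the shifts from `8 * b` up to `16 * b`. In each, step plus width is exactly
-- half the lower end, so `sound` applies without its additive 5. The reciprocals of the steps add
-- up to `8 / (6 * b)`.
octave : (b : ℕ) .{{_ : NonZero b}} → List Class
octave b@(suc _) =
    class (8 * b)                 (2 * b) (2 * b)
  ∷ class (8 * b + 2 * b)         (2 * b) (3 * b)
  ∷ class (8 * b + 2 * b + 2 * b) (4 * b) (2 * b)
  ∷ []

octave-sound : ∀ b .{{_ : NonZero b}} → All Sound (octave b)
octave-sound b@(suc _) =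
          sound 2≤8b (*-monoˡ-≤ b 2≤8) (≤-trans (≤-reflexive (eq₁ b)) (m≤n+m _ 5))
  All.∷ sound (m≤n⇒m≤n+o _ 2≤8b) (m≤n⇒m≤n+o _ (*-monoˡ-≤ b 3≤8))
          (≤-trans (≤-reflexive (eq₂ b)) (m≤n+m _ 5))
  All.∷ sound (m≤n⇒m≤n+o _ (m≤n⇒m≤n+o _ 2≤8b)) (m≤n⇒m≤n+o _ (m≤n⇒m≤n+o _ (*-monoˡ-≤ b 2≤8)))
          (≤-trans (≤-reflexive (eq₃ b)) (m≤n+m _ 5))
  All.∷ All.[]
  where
  2≤8 : 2 ≤ 8
  2≤8 = ≤ᵇ⇒≤ 2 8 _

  3≤8 : 3 ≤ 8
  3≤8 = ≤ᵇ⇒≤ 3 8 _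

  2≤8b : 2 ≤ 8 * b
  2≤8b = ≤-trans 2≤8 (m≤m*n 8 b)

  eq₁ : ∀ b → 2 * (2 * b + 2 * b) ≡ 8 * b
  eq₁ = solve-∀

  eq₂ : ∀ b → 2 * (3 * b + 2 * b) ≡ 8 * b + 2 * b
  eq₂ = solve-∀

  eq₃ : ∀ b → 2 * (2 * b + 4 * b) ≡ 8 * b + 2 * b + 2 * b
  eq₃ = solve-∀

octave-cover : ∀ b .{{_ : NonZero b}} → Covers (8 * b) (8 * (2 * b)) (octave b)
octave-cover b@(suc _) = covers-∷ (covers-∷ (covers-∷
  (subst (λ h → Covers (8 * b + 2 * b + 2 * b + 4 * b) h []) (total b) covers-[])))
  where
  total : ∀ b → 8 * b + 2 * b + 2 * b + 4 * b ≡ 8 * (2 * b)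
  total = solve-∀

blocks-octave : ∀ n b .{{_ : NonZero b}} → blocks n (octave b) * (6 * b) ≤ 8 * n
blocks-octave n b@(suc a) =
  bound b (n / (2 * b)) (n / (3 * b)) (m/n*n≤m n (2 * b)) (m/n*n≤m n (3 * b))
  where
  bound : ∀ b x y → x * (2 * b) ≤ n → y * (3 * b) ≤ n → (x + (y + (x + 0))) * (6 * b) ≤ 8 * n
  bound b x y x≤ y≤ = ≤-by 0 (+-mono-≤ (*-monoʳ-≤ 6 x≤) (*-monoʳ-≤ 2 y≤))
    (identity b x y n)
    where
    identity : ∀ b x y n → 6 * n + 2 * n + (x + (y + (x + 0))) * (6 * b) + 0 ≡
                           6 * (x * (2 * b)) + 2 * (y * (3 * b)) + 8 * n
    identity = solve-∀

octaves : ℕ → (b : ℕ) .{{_ : NonZero b}} → List Class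
octaves zero    _         = []
octaves (suc j) b@(suc _) = octave b ++ octaves j (2 * b)

octaves-sound : ∀ j b .{{_ : NonZero b}} → All Sound (octaves j b)
octaves-sound zero    _         = All.[]
octaves-sound (suc j) b@(suc _) = ++⁺ (octave-sound b) (octaves-sound j (2 * b))

-- The octaves in fact reach `8 * b` times the `j`-th power of 2; the linear bound is cruder but
-- suffices, as no shift exceeds `n`.
octaves-cover : ∀ j b .{{_ : NonZero b}} → Covers (8 * b) (j + 8 * b) (octaves j b)
octaves-cover zero    b         = covers-[]
octaves-cover (suc j) b@(suc a) 8b≤q q<h =
  covers-++ (octave-cover b) (octaves-cover j (2 * b)) 8b≤q (<-≤-trans q<h h≤h′)
  where
  h≤h′ : suc j + 8 * b ≤ j + 8 * (2 * b)
  h≤h′ = m+n≤o⇒m≤o _ (≤-reflexive (identity j a))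
    where
    identity : ∀ j a → suc j + 8 * suc a + (7 + 8 * a) ≡ j + 8 * (2 * suc a)
    identity = solve-∀

-- A geometric series: the bound for each octave is half the previous one, so all together stay
-- below twice the first bound `8 * n / (6 * b)`.
blocks-octaves : ∀ n j b .{{_ : NonZero b}} → blocks n (octaves j b) * (6 * b) ≤ 16 * n
blocks-octaves n zero    _         = z≤n
blocks-octaves n (suc j) b@(suc _) = subst (λ t → t * (6 * b) ≤ 16 * n)
  (sym (blocks-++ n (octave b) (octaves j (2 * b))))
  (bound b (blocks n (octave b)) (blocks n (octaves j (2 * b)))
    (blocks-octave n b) (blocks-octaves n j (2 * b)))
  where
  bound : ∀ b x y → x * (6 * b) ≤ 8 * n → y * (6 * (2 * b)) ≤ 16 * n → (x + y) * (6 * b) ≤ 16 * n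
  bound b x y x≤ y≤ = *-cancelˡ-≤ 2 (≤-by 0 (+-mono-≤ (*-monoʳ-≤ 2 x≤) y≤)
    (identity b x y n))
    where
    identity : ∀ b x y n → 2 * (8 * n) + 16 * n + 2 * ((x + y) * (6 * b)) + 0 ≡
                           2 * (x * (6 * b)) + y * (6 * (2 * b)) + 2 * (16 * n)
    identity = solve-∀

mainClasses : ℕ → List Class
mainClasses n = smallClasses ++ octaves n 2

mainClasses-sound : ∀ n → All Sound (mainClasses n)
mainClasses-sound n = ++⁺ smallClasses-sound (octaves-sound n 2)

mainClasses-cover : ∀ n → Covers 2 (n + 16) (mainClasses n)
mainClasses-cover n = covers-++ smallClasses-cover (octaves-cover n 2)

blocks-mainClasses : ∀ n → 12 * blocks n (mainClasses n) ≤ 41 * n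
blocks-mainClasses n = subst (λ t → 12 * t ≤ 41 * n)
  (sym (blocks-++ n smallClasses (octaves n 2)))
  (bound (blocks n smallClasses) (blocks n (octaves n 2)) (blocks-smallClasses n) (blocks-octaves n n 2))
  where
  bound : ∀ x y → 12 * x ≤ 25 * n → y * 12 ≤ 16 * n → 12 * (x + y) ≤ 41 * n
  bound x y x≤ y≤ = ≤-by 0 (+-mono-≤ x≤ y≤) (identity x y n)
    where
    identity : ∀ x y n → 25 * n + 16 * n + 12 * (x + y) + 0 ≡ 12 * x + y * 12 + 41 * n
    identity = solve-∀

-- Squares created by an insertion

Bounded : Direction → ℕ → ℕ → ℕ → Set
Bounded leftward  n q g = q ≤ g × g ≤ n
Bounded rightward n q g = g + q ≤ n

-- In a square U·xVUxV (rightward) or UxVU·xV (leftward) with x inserted at g, a run on V starts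
-- at g and a run on U ends at g.  Its shift is the period of the square if the inserted x does
-- not lie between the two occurrences (leftward U, rightward V), and one less otherwise.
letter : Direction → Side → (ℕ → A) → ℕ → ℕ → A
letter leftward  ending   w q g = w (g ∸ q)
letter leftward  starting w q g = w (g ∸ suc q)
letter rightward starting w q g = w (pred (g + q))
letter rightward ending   w q g = w (g + q)

-- A shift equal to the period is at least 1. A shift one less is `u + v` with U and V both
-- nonempty, hence at least 2; those kinds avoid the costly shift 1.
least : Direction → Side → ℕ
least leftward  ending   = 1
least leftward  starting = 2
least rightward starting = 1
least rightward ending   = 2

Event : Direction → Side → (ℕ → A) → ℕ → ℕ → ℕ → Set
Event dir side w n q g =
  Bounded dir n q g × ∃ λ ℓ → Long q ℓ × Run side (Match dir w n q) ℓ g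

Forbids : (ℕ → A) → ℕ → ℕ → A → Set
Forbids w n g x = ∃₂ λ dir side → ∃ λ q →
  least dir side ≤ q × Event dir side w n q g × x ≡ letter dir side w q g

repeat⇒square : ∀ {w : ℕ → A} {n t} → suc t < n → w t ≡ w (suc t) → HasSquare w n
repeat⇒square {w = w} {n} {t} t+1<n eq =
  t , 1 , z<s , subst (_≤ n) (+-comm 2 t) t+1<n , λ where
    (s≤s z≤n) → trans (cong w (+-identityʳ t)) (trans eq (cong w (sym (trans (+-identityʳ (t + 1)) (+-comm t 1)))))

m+n+o∸n≡m+o : ∀ m n o → m + n + o ∸ n ≡ m + o
m+n+o∸n≡m+o m n o = trans (cong (_∸ n) (identity m n o)) (m+n∸m≡n n (m + o))
  where
  identity : ∀ m n o → m + n + o ≡ n + (m + o)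
  identity = solve-∀

m+[1+n]+o∸n≡1+m+o : ∀ m n o → m + suc n + o ∸ n ≡ suc (m + o)
m+[1+n]+o∸n≡1+m+o m n o =
  trans (cong (λ t → t + o ∸ n) (+-suc m n)) (m+n+o∸n≡m+o (suc m) n o)

module _ {w : ℕ → A} {n : ℕ} (¬square : ¬ HasSquare w n) where

  open ≡-Reasoning

  -- U·VUxV occurs at position a, and UxVU·V respectively, with |U| = u and |V| = v.
  RightPunctured : ℕ → ℕ → ℕ → Set _
  RightPunctured a u v =
    a + (suc (u + v) + suc (u + v)) ≤ suc n ×
    (∀ {i} → i < u → w (a + i) ≡ w (a + i + (u + v))) ×
    (∀ {i} → i < v → w (a + u + i) ≡ w (a + u + i + suc (u + v)))

  LeftPunctured : ℕ → ℕ → ℕ → Set _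
  LeftPunctured a u v =
    a + (suc (u + v) + suc (u + v)) ≤ suc n ×
    (∀ {i} → i < u → w (a + suc (u + v) + i) ≡ w (a + i)) ×
    (∀ {i} → i < v → w (a + suc (u + v) + u + i) ≡ w (suc (a + u + i)))

  -- Suppose that the letter before the gap matches as well. If U is empty, it extends the
  -- repetition of V to a full square. Otherwise it is the last letter of U and equals two adjacent
  -- letters, one through the repetition of U and one through the match.
  right-maximal-V : ∀ a u v → RightPunctured a u v → ∀ {t} → suc t ≡ a + u →
                    ¬ Match rightward w n (suc (u + v)) t
  right-maximal-V zero zero v _ ()
  right-maximal-V (suc a) zero v (inside , _ , eqⱽ) t+1≡a+0 matchₜ =
    ¬square (a , suc v , z<s , s≤s⁻¹ inside , eq)
    where
    match : w a ≡ w (a + suc v)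
    match = proj₂ (subst (Match rightward w n (suc v))
      (trans (suc-injective t+1≡a+0) (+-identityʳ a)) matchₜ)

    eq : ∀ {i} → i < suc v → w (a + i) ≡ w (a + suc v + i)
    eq {zero} _ = begin
      w (a + 0)           ≡⟨ cong w (+-identityʳ a) ⟩
      w a                 ≡⟨ match ⟩
      w (a + suc v)       ≡⟨ cong w (+-identityʳ (a + suc v)) ⟨
      w (a + suc v + 0)   ∎
    eq {suc i} (s≤s i<v) = begin
      w (a + suc i)               ≡⟨ cong w (solve (a ∷ i ∷ [])) ⟩
      w (suc a + 0 + i)           ≡⟨ eqⱽ i<v ⟩
      w (suc a + 0 + i + suc v)   ≡⟨ cong w (solve (a ∷ i ∷ v ∷ [])) ⟩
      w (a + suc v + suc i)       ∎
  right-maximal-V a (suc u) v (inside , eqᵁ , _) t+1≡a+u matchₜ =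
    ¬square (repeat⇒square {w = w} {n = n} {t = a + u + (suc u + v)}
      (≤-by v inside (solve (a ∷ u ∷ v ∷ n ∷ [])))
      (begin
        w (a + u + (suc u + v))       ≡⟨ eqᵁ ≤-refl ⟨
        w (a + u)                     ≡⟨ match ⟩
        w (a + u + suc (suc u + v))   ≡⟨ cong w (+-suc (a + u) (suc u + v)) ⟩
        w (suc (a + u + (suc u + v))) ∎))
    where
    match : w (a + u) ≡ w (a + u + suc (suc u + v))
    match = proj₂ (subst (Match rightward w n (suc (suc u + v)))
      (suc-injective (trans t+1≡a+u (+-suc a u))) matchₜ)

  right-starting : ∀ a u v → RightPunctured a u v → Long (suc (u + v)) v →
                   Event rightward starting w n (suc (u + v)) (a + u)
  right-starting a u v punctured@(inside , _ , eqⱽ) long =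
    ≤-by v inside (solve (a ∷ u ∷ v ∷ n ∷ [])) , v , long ,
    (λ {i} i<v → ≤-by 0 (+-mono-≤ i<v inside) (solve (a ∷ u ∷ v ∷ i ∷ n ∷ [])) , eqⱽ i<v) ,
    right-maximal-V a u v punctured

  -- With V empty, U·VUxV begins with UU.
  right-0<v : ∀ a u v → 0 < u → RightPunctured a u v → 0 < v
  right-0<v a u zero 0<u (inside , eqᵁ , _) = ⊥-elim (¬square (a , u , 0<u ,
    ≤-by 1 inside (solve (a ∷ u ∷ n ∷ [])) , λ {i} i<u → begin
      w (a + i)             ≡⟨ eqᵁ i<u ⟩
      w (a + i + (u + 0))   ≡⟨ cong w (solve (a ∷ u ∷ i ∷ [])) ⟩
      w (a + u + i)         ∎))
  right-0<v a u (suc v) _ _ = z<s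

  -- The first letter of V would equal two adjacent letters, one through the match and one through
  -- the repetition of V.
  right-maximal-U : ∀ a u v → 0 < v → RightPunctured a u v →
                    ¬ Match rightward w n (u + v) (a + u)
  right-maximal-U a u (suc v) _ (inside , _ , eqⱽ) (_ , match) =
    ¬square (repeat⇒square {w = w} {n = n} {t = a + u + (u + suc v)}
      (≤-by v inside (solve (a ∷ u ∷ v ∷ n ∷ [])))
      (begin
        w (a + u + (u + suc v))             ≡⟨ match ⟨
        w (a + u)                           ≡⟨ cong w (+-identityʳ (a + u)) ⟨
        w (a + u + 0)                       ≡⟨ eqⱽ z<s ⟩
        w (a + u + 0 + suc (u + suc v))     ≡⟨ cong w (solve (a ∷ u ∷ v ∷ [])) ⟩
        w (suc (a + u + (u + suc v)))       ∎))

  right-ending : ∀ a u v → 0 < v → v ≤ u → RightPunctured a u v →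
                 Event rightward ending w n (u + v) (a + u)
  right-ending a u v 0<v v≤u punctured@(inside , eqᵁ , _) =
    ≤-by (suc v) inside (solve (a ∷ u ∷ v ∷ n ∷ [])) , u , inj₂ (+-monoʳ-≤ u v≤u) ,
    (a , refl , λ {i} i<u →
      ≤-by (suc v) (+-mono-≤ i<u inside) (solve (a ∷ u ∷ v ∷ i ∷ n ∷ [])) , eqᵁ i<u) ,
    right-maximal-U a u v 0<v punctured

  -- If V is empty, a match at the gap completes the two copies of U to a square of period `suc u`.
  -- Otherwise the letter at the gap is the first of V and equals two adjacent letters.
  left-maximal-U : ∀ a u v → LeftPunctured a u v →
                   ¬ Match leftward w n (suc (u + v)) (a + suc (u + v) + u)
  left-maximal-U a u zero (_ , eqᵁ , _) (_ , g<n , match) =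
    ¬square (a , suc u , z<s , ≤-by 0 g<n (solve (a ∷ u ∷ n ∷ [])) , λ {i} i≤u → eq i≤u)
    where
    eq : ∀ {i} → i < suc u → w (a + i) ≡ w (a + suc u + i)
    eq {i} i≤u with m<1+n⇒m<n∨m≡n i≤u
    ... | inj₁ i<u  = begin
      w (a + i)                 ≡⟨ eqᵁ i<u ⟨
      w (a + suc (u + 0) + i)   ≡⟨ cong w (solve (a ∷ u ∷ i ∷ [])) ⟩
      w (a + suc u + i)         ∎
    ... | inj₂ refl = begin
      w (a + u)                                   ≡⟨ cong w (m+n+o∸n≡m+o a (suc (u + 0)) u) ⟨
      w (a + suc (u + 0) + u ∸ suc (u + 0))       ≡⟨ match ⟨
      w (a + suc (u + 0) + u)                     ≡⟨ cong w (solve (a ∷ u ∷ [])) ⟩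
      w (a + suc u + u)                           ∎
  left-maximal-U a u (suc v) (inside , _ , eqⱽ) (_ , g<n , match) =
    ¬square (repeat⇒square {w = w} {n = n} {t = a + u}
      (≤-by (u + suc v) g<n (solve (a ∷ u ∷ v ∷ n ∷ [])))
      (begin
        w (a + u)                       ≡⟨ cong w (m+n+o∸n≡m+o a p u) ⟨
        w (a + p + u ∸ p)               ≡⟨ match ⟨
        w (a + p + u)                   ≡⟨ cong w (+-identityʳ (a + p + u)) ⟨
        w (a + p + u + 0)               ≡⟨ eqⱽ z<s ⟩
        w (suc (a + u + 0))             ≡⟨ cong (λ t → w (suc t)) (+-identityʳ (a + u)) ⟩
        w (suc (a + u))                 ∎))
    where
    p : ℕ
    p = suc (u + suc v)

  left-ending : ∀ a u v → LeftPunctured a u v → a + suc (u + v) + u ≤ n → Long (suc (u + v)) u →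
                Event leftward ending w n (suc (u + v)) (a + suc (u + v) + u)
  left-ending a u v punctured@(inside , eqᵁ , _) g≤n long =
    (≤-trans (m≤n+m p a) (m≤m+n (a + p) u) , g≤n) , u , long ,
    (a + p , refl , λ {i} i<u →
      ≤-trans (m≤n+m p a) (m≤m+n (a + p) i) ,
      <-≤-trans (+-monoʳ-< (a + p) i<u) g≤n ,
      (begin
        w (a + p + i)       ≡⟨ eqᵁ i<u ⟩
        w (a + i)           ≡⟨ cong w (m+n+o∸n≡m+o a p i) ⟨
        w (a + p + i ∸ p)   ∎)) ,
    left-maximal-U a u v punctured
    where
    p : ℕ
    p = suc (u + v)

  -- With U empty, UxVU·V ends with VV.
  left-0<u : ∀ a u v → 0 < v → LeftPunctured a u v → 0 < u
  left-0<u a zero v 0<v (inside , _ , eqⱽ) = ⊥-elim (¬square (suc a , v , 0<v ,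
    ≤-by 0 inside (solve (a ∷ v ∷ n ∷ [])) , λ {i} i<v → begin
      w (suc a + i)           ≡⟨ cong w (solve (a ∷ i ∷ [])) ⟩
      w (suc (a + 0 + i))     ≡⟨ eqⱽ i<v ⟨
      w (a + suc v + 0 + i)   ≡⟨ cong w (solve (a ∷ v ∷ i ∷ [])) ⟩
      w (suc a + v + i)       ∎))
  left-0<u a (suc u) v _ _ = z<s

  left-maximal-V : ∀ a u v → 0 < u → LeftPunctured a u v → ∀ {t} → suc t ≡ a + suc (u + v) + u →
                   ¬ Match leftward w n (u + v) t
  left-maximal-V a (suc u) v _ (inside , eqᵁ , _) t+1≡g matchₜ =
    ¬square (repeat⇒square {w = w} {n = n} {t = a + u}
      (≤-by (u + v + suc v) inside (solve (a ∷ u ∷ v ∷ n ∷ [])))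
      (begin
        w (a + u)                       ≡⟨ eqᵁ ≤-refl ⟨
        w (a + suc q + u)               ≡⟨ match ⟩
        w (a + suc q + u ∸ q)           ≡⟨ cong w (m+[1+n]+o∸n≡1+m+o a q u) ⟩
        w (suc (a + u))                 ∎))
    where
    q : ℕ
    q = suc u + v

    match : w (a + suc q + u) ≡ w (a + suc q + u ∸ q)
    match = proj₂ (proj₂ (subst (Match leftward w n q)
      (suc-injective (trans t+1≡g (+-suc (a + suc q) u))) matchₜ))

  left-starting : ∀ a u v → 0 < u → u ≤ v → LeftPunctured a u v → a + suc (u + v) + u ≤ n →
                  Event leftward starting w n (u + v) (a + suc (u + v) + u)
  left-starting a u v 0<u u≤v punctured@(inside , _ , eqⱽ) g≤n =
    (≤-by {0} {0} (suc (a + u)) z≤n (solve (a ∷ u ∷ v ∷ [])) , g≤n) , v , inj₂ (+-monoˡ-≤ v u≤v) ,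
    (λ {i} i<v →
      ≤-by {0} {0} (suc (a + u + i)) z≤n (solve (a ∷ u ∷ v ∷ i ∷ [])) ,
      ≤-by 0 (+-mono-≤ i<v inside) (solve (a ∷ u ∷ v ∷ i ∷ n ∷ [])) ,
      (begin
        w (a + suc q + u + i)           ≡⟨ eqⱽ i<v ⟩
        w (suc (a + u + i))             ≡⟨ cong (λ t → w (suc t)) (+-assoc a u i) ⟩
        w (suc (a + (u + i)))           ≡⟨ cong w (m+[1+n]+o∸n≡1+m+o a q (u + i)) ⟨
        w (a + suc q + (u + i) ∸ q)     ≡⟨ cong (λ t → w (t ∸ q)) (+-assoc (a + suc q) u i) ⟨
        w (a + suc q + u + i ∸ q)       ∎)) ,
    left-maximal-V a u v 0<u punctured
    where
    q : ℕ
    q = u + v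

  module _ {x : A} where

    ins-suc : ∀ {g t t′} → g ≤ t → t′ ≡ suc t → ins g x w t′ ≡ w t
    ins-suc g≤t refl = ins-> x w g≤t

    forbids-right : ∀ a u v → a + (suc (u + v) + suc (u + v)) ≤ suc n →
      (∀ {i} → i < suc (u + v) → ins (a + u) x w (a + i) ≡ ins (a + u) x w (a + suc (u + v) + i)) →
      Forbids w n (a + u) x
    forbids-right a u v inside eq = by-cases (v ≤? u)
      where
      x≡ : x ≡ w (a + u + (u + v))
      x≡ = begin
        x                                       ≡⟨ ins-≡ (a + u) x w ⟨
        ins (a + u) x w (a + u)                 ≡⟨ eq (s≤s (m≤m+n u v)) ⟩
        ins (a + u) x w (a + suc (u + v) + u)   ≡⟨ ins-suc (m≤m+n (a + u) (u + v)) (identity a u v) ⟩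
        w (a + u + (u + v))                     ∎
        where
        identity : ∀ a u v → a + suc (u + v) + u ≡ suc (a + u + (u + v))
        identity = solve-∀

      -- Letters after the gap stand one place earlier in `w`, so the two copies of U, which have
      -- the inserted letter between them, are only `u + v` apart.
      punctured : RightPunctured a u v
      punctured = inside ,
        (λ {i} i<u → begin
          w (a + i)                               ≡⟨ ins-< x w (+-monoʳ-< a i<u) ⟨
          ins (a + u) x w (a + i)                 ≡⟨ eq (m≤n⇒m≤1+n (m≤n⇒m≤n+o v i<u)) ⟩
          ins (a + u) x w (a + suc (u + v) + i)   ≡⟨ ins-suc (m+n≤o⇒m≤o (a + u) (≤-reflexive (id₁ a i u v))) (id₂ a i u v) ⟩
          w (a + i + (u + v))                     ∎) ,
        (λ {i} i<v → begin
          w (a + u + i)                               ≡⟨ ins-suc (m≤m+n (a + u) i) (id₃ a i u) ⟨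
          ins (a + u) x w (a + suc (u + i))           ≡⟨ eq (s≤s (+-monoʳ-< u i<v)) ⟩
          ins (a + u) x w (a + suc (u + v) + suc (u + i))
            ≡⟨ ins-suc (m+n≤o⇒m≤o (a + u) (≤-reflexive (id₄ a i u v))) (id₅ a i u v) ⟩
          w (a + u + i + suc (u + v))                 ∎)
        where
        id₁ : ∀ a i u v → (a + u) + (i + v) ≡ a + i + (u + v)
        id₁ = solve-∀
        id₂ : ∀ a i u v → a + suc (u + v) + i ≡ suc (a + i + (u + v))
        id₂ = solve-∀
        id₃ : ∀ a i u → a + suc (u + i) ≡ suc (a + u + i)
        id₃ = solve-∀
        id₄ : ∀ a i u v → (a + u) + (i + suc (u + v)) ≡ a + u + i + suc (u + v)
        id₄ = solve-∀
        id₅ : ∀ a i u v → a + suc (u + v) + suc (u + i) ≡ suc (a + u + i + suc (u + v))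
        id₅ = solve-∀

      starting′ : Long (suc (u + v)) v → Forbids w n (a + u) x
      starting′ long = rightward , starting , suc (u + v) , s≤s z≤n ,
        right-starting a u v punctured long , trans x≡ (cong (λ t → w (pred t)) (sym (+-suc (a + u) (u + v))))

      by-cases : Dec (v ≤ u) → Forbids w n (a + u) x
      by-cases (no v≰u)  = starting′ (inj₂ (+-monoˡ-≤ v (≰⇒> v≰u)))
      by-cases (yes v≤u) with u ≟ 0
      -- U empty and `v ≤ u` leave only the square `xx`: shift 1 with an empty run.
      ... | yes refl = starting′ (inj₁ (s≤s v≤u))
      ... | no  u≢0  = rightward , ending , u + v , +-mono-≤ 0<u 0<v ,
        right-ending a u v 0<v v≤u punctured , x≡
        where
        0<u : 0 < u
        0<u = n≢0⇒n>0 u≢0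
        0<v : 0 < v
        0<v = right-0<v a u v 0<u punctured

    forbids-left : ∀ a u v → a + (suc (u + v) + suc (u + v)) ≤ suc n → a + suc (u + v) + u ≤ n →
      (∀ {i} → i < suc (u + v) → ins (a + suc (u + v) + u) x w (a + i) ≡
                                 ins (a + suc (u + v) + u) x w (a + suc (u + v) + i)) →
      Forbids w n (a + suc (u + v) + u) x
    forbids-left a u v inside g≤n eq = by-cases (u ≤? v)
      where
      p g : ℕ
      p = suc (u + v)
      g = a + p + u

      x≡ : x ≡ w (a + u)
      x≡ = begin
        x               ≡⟨ ins-≡ g x w ⟨
        ins g x w g     ≡⟨ eq (s≤s (m≤m+n u v)) ⟨
        ins g x w (a + u) ≡⟨ ins-< x w (+-monoˡ-< u (m<m+n a z<s)) ⟩
        w (a + u)       ∎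

      punctured : LeftPunctured a u v
      punctured = inside ,
        (λ {i} i<u → begin
          w (a + p + i)         ≡⟨ ins-< x w (+-monoʳ-< (a + p) i<u) ⟨
          ins g x w (a + p + i) ≡⟨ eq (m≤n⇒m≤1+n (m≤n⇒m≤n+o v i<u)) ⟨
          ins g x w (a + i)     ≡⟨ ins-< x w (+-mono-<-≤ (m<m+n a z<s) (<⇒≤ i<u)) ⟩
          w (a + i)             ∎) ,
        (λ {i} i<v → begin
          w (g + i)                         ≡⟨ ins-suc (m≤m+n g i) (id₁ a p u i) ⟨
          ins g x w (a + p + suc (u + i))   ≡⟨ eq (s≤s (+-monoʳ-< u i<v)) ⟨
          ins g x w (a + suc (u + i))       ≡⟨ ins-< x w (m≤n⇒m≤n+o u (+-monoʳ-< a (s≤s (+-monoʳ-< u i<v)))) ⟩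
          w (a + suc (u + i))               ≡⟨ cong w (id₂ a u i) ⟩
          w (suc (a + u + i))               ∎)
        where
        id₁ : ∀ a p u i → a + p + suc (u + i) ≡ suc (a + p + u + i)
        id₁ = solve-∀
        id₂ : ∀ a u i → a + suc (u + i) ≡ suc (a + u + i)
        id₂ = solve-∀

      ending′ : Long p u → Forbids w n g x
      ending′ long = leftward , ending , p , s≤s z≤n ,
        left-ending a u v punctured g≤n long , trans x≡ (cong w (sym (m+n+o∸n≡m+o a p u)))

      by-cases : Dec (u ≤ v) → Forbids w n g x
      by-cases (no u≰v)  = ending′ (inj₂ (subst (_≤ u + u) (+-suc u v) (+-monoʳ-≤ u (≰⇒> u≰v))))
      by-cases (yes u≤v) with v ≟ 0
      ... | yes refl = ending′ (inj₁ (s≤s (subst (_≤ 0) (sym (+-identityʳ u)) u≤v)))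
      ... | no  v≢0  = leftward , starting , u + v , +-mono-≤ 0<u 0<v ,
        left-starting a u v 0<u u≤v punctured g≤n ,
        trans x≡ (cong w (sym (m+n+o∸n≡m+o a p u)))
        where
        0<v : 0 < v
        0<v = n≢0⇒n>0 v≢0
        0<u : 0 < u
        0<u = left-0<u a u v 0<v punctured

    -- The inserted letter lies in one of the two halves of the square, since a square that misses
    -- it would already occur in `w`.
    forbids : ∀ {g} → g ≤ n → HasSquare (ins g x w) (suc n) → Forbids w n g x
    forbids {g} g≤n (a , p , 0<p , inside , eq) with a ≤? g
    forbids {g} g≤n (zero , p , 0<p , inside , eq) | no a≰g = ⊥-elim (a≰g z≤n)
    forbids {g} g≤n (suc a , p , 0<p , inside , eq) | no a≰g =
      ⊥-elim (¬square (a , p , 0<p , s≤s⁻¹ inside , λ {i} i<p → begin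
        w (a + i)                   ≡⟨ ins-> x w (m≤n⇒m≤n+o i g≤a) ⟨
        ins g x w (suc a + i)       ≡⟨ eq i<p ⟩
        ins g x w (suc a + p + i)   ≡⟨ ins-> x w (m≤n⇒m≤n+o i (m≤n⇒m≤n+o p g≤a)) ⟩
        w (a + p + i)               ∎))
      where
      g≤a : g ≤ a
      g≤a = s≤s⁻¹ (≰⇒> a≰g)
    ... | yes a≤g with g <? a + p
    ...   | yes g<a+p
      -- `g = a + u` and `p = suc (u + v)`: U and V are the parts of the half before and after the
      -- inserted letter.
      with u , refl ← m≤n⇒∃[o]m+o≡n a≤g
      with v , refl ← m≤n⇒∃[o]m+o≡n (+-cancelˡ-< a u p g<a+p) = forbids-right a u v inside eq
    ...   | no g≮a+p with g <? a + p + p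
    ...     | yes g<a+2p
      with u , refl ← m≤n⇒∃[o]m+o≡n (≮⇒≥ g≮a+p)
      with v , refl ← m≤n⇒∃[o]m+o≡n (+-cancelˡ-< (a + p) u p g<a+2p) =
        forbids-left a u v inside g≤n eq
    ...     | no g≮a+2p =
      ⊥-elim (¬square (a , p , 0<p , subst (_≤ n) (+-assoc a p p) (≤-trans (≮⇒≥ g≮a+2p) g≤n) , λ {i} i<p → begin
        w (a + i)               ≡⟨ ins-< x w (<-≤-trans (+-monoʳ-< a i<p) (≮⇒≥ g≮a+p)) ⟨
        ins g x w (a + i)       ≡⟨ eq i<p ⟩
        ins g x w (a + p + i)   ≡⟨ ins-< x w (<-≤-trans (+-monoʳ-< (a + p) i<p) (≮⇒≥ g≮a+2p)) ⟩
        w (a + p + i)           ∎))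

-- Counting

-- Subtracting s keeps the last, possibly incomplete, block of length s from being used.
block : Direction → (s : ℕ) .{{_ : NonZero s}} → ℕ → ℕ
block leftward  s g = (g ∸ s) / s
block rightward s g = g / s

m/s<n/s : ∀ {m n} s .{{_ : NonZero s}} → m + s ≤ n → m / s < n / s
m/s<n/s {m} {n} s m+s≤n = begin
  1 + m / s         ≤⟨ +-monoʳ-≤ 1 (/-monoˡ-≤ s (m+n≤o⇒m≤o∸n m m+s≤n)) ⟩
  1 + (n ∸ s) / s   ≡⟨ m/n≡1+[m∸n]/n (m+n≤o⇒n≤o m m+s≤n) ⟨
  n / s             ∎
  where open ≤-Reasoning

m/s≡[m+k]/s⇒k<s : ∀ m {k} s .{{_ : NonZero s}} → m / s ≡ (m + k) / s → k < s
m/s≡[m+k]/s⇒k<s m {k} s eq = +-cancelˡ-< m k s (begin-strict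
  m + k                           ≡⟨ m≡m%n+[m/n]*n (m + k) s ⟩
  (m + k) % s + (m + k) / s * s   ≡⟨ cong (λ t → (m + k) % s + t * s) eq ⟨
  (m + k) % s + m / s * s         <⟨ +-mono-<-≤ (m%n<n (m + k) s) (m/n*n≤m m s) ⟩
  s + m                           ≡⟨ +-comm s m ⟩
  m + s                           ∎)
  where open ≤-Reasoning

-- The shift leaves at least `s` letters on its side of the gap, so `g` or `g ∸ s` lies in one of
-- the `n / s` complete blocks.
block-< : ∀ dir {n q g} s .{{_ : NonZero s}} → s ≤ q → Bounded dir n q g → block dir s g < n / s
block-< leftward  {g = g} s s≤q (q≤g , g≤n) =
  m/s<n/s s (≤-trans (≤-reflexive (m∸n+n≡m (≤-trans s≤q q≤g))) g≤n)
block-< rightward {g = g} s s≤q g+q≤n = m/s<n/s s (≤-trans (+-monoʳ-≤ g s≤q) g+q≤n)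

block-≡ : ∀ dir {n q g k} s .{{_ : NonZero s}} → s ≤ q → Bounded dir n q g →
          block dir s g ≡ block dir s (g + k) → k < s
block-≡ leftward  {g = g} {k} s s≤q (q≤g , _) eq =
  m/s≡[m+k]/s⇒k<s (g ∸ s) s (trans eq (cong (_/ s) (+-∸-comm k (≤-trans s≤q q≤g))))
block-≡ rightward {g = g} s _ _ eq = m/s≡[m+k]/s⇒k<s g s eq

∈ᶜ-close : ∀ {c q q′} → q ∈ᶜ c → q′ ∈ᶜ c → q < q′ + width c
∈ᶜ-close {c} (_ , q<) (≤q′ , _) = <-≤-trans q< (+-monoˡ-≤ (width c) ≤q′)

module _ {w : ℕ → A} {n : ℕ} (¬square : ¬ HasSquare w n) where

  -- Gaps in one block are less than `step c` apart, and soundness gives the run lengths that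
  -- `run-separation` requires at that distance.
  ordered-event-separation : ∀ dir side {c q q′ g g′} → Sound c → q ∈ᶜ c → q′ ∈ᶜ c →
    Event dir side w n q g → Event dir side w n q′ g′ → g ≤ g′ →
    block dir (step c) g ≡ block dir (step c) g′ → g ≡ g′ × q ≡ q′
  ordered-event-separation dir side {c} {q} {q′} {g} (s≤lo , separated) q∈c q′∈c
    (bounded , ℓ , long , run) (_ , ℓ′ , long′ , run′) g≤g′ eq
    with k , refl ← m≤n⇒∃[o]m+o≡n g≤g′
    with refl , q≡q′ ← run-separation (λ q y 0<d m m′ → ¬square (matches⇒square dir q y 0<d m m′))
           side {e = width c} k run run′ (separated q∈c long) (separated q′∈c long′)
           (∈ᶜ-close {c} q∈c q′∈c) (∈ᶜ-close {c} q′∈c q∈c)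
           (block-≡ dir (step c) (≤-trans s≤lo (proj₁ q∈c)) bounded eq)
    = sym (+-identityʳ g) , q≡q′

  event-separation : ∀ dir side {c q q′ g g′} → Sound c → q ∈ᶜ c → q′ ∈ᶜ c →
    Event dir side w n q g → Event dir side w n q′ g′ →
    block dir (step c) g ≡ block dir (step c) g′ → g ≡ g′ × q ≡ q′
  event-separation dir side {c} {g = g} {g′} sound-c q∈c q′∈c event event′ eq with ≤-total g g′
  ... | inj₁ g≤g′ = ordered-event-separation dir side {c} sound-c q∈c q′∈c event event′ g≤g′ eq
  ... | inj₂ g′≤g
    with refl , refl ← ordered-event-separation dir side {c} sound-c q′∈c q∈c event′ event g′≤g (sym eq)
    = refl , refl

classes : Direction → Side → ℕ → List Class
classes leftward  ending   n = unitClass ∷ mainClasses n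
classes leftward  starting n = mainClasses n
classes rightward starting n = unitClass ∷ mainClasses n
classes rightward ending   n = mainClasses n

classes-sound : ∀ dir side n → All Sound (classes dir side n)
classes-sound leftward  ending   n = unitClass-sound All.∷ mainClasses-sound n
classes-sound leftward  starting n = mainClasses-sound n
classes-sound rightward starting n = unitClass-sound All.∷ mainClasses-sound n
classes-sound rightward ending   n = mainClasses-sound n

classes-cover : ∀ dir side n → Covers (least dir side) (n + 16) (classes dir side n)
classes-cover leftward  ending   n = covers-∷ (mainClasses-cover n)
classes-cover leftward  starting n = mainClasses-cover n
classes-cover rightward starting n = covers-∷ (mainClasses-cover n)
classes-cover rightward ending   n = mainClasses-cover n

-- Encoding pairs of a gap and a letter

Code : Set
Code = Direction × Side × Class × ℕ

kindCodes : Direction → Side → ℕ → List Class → List Code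
kindCodes dir side n = concatMap (λ c → map (λ b → dir , side , c , b) (upTo (n / step c)))

length-kindCodes : ∀ dir side n cs → length (kindCodes dir side n cs) ≡ blocks n cs
length-kindCodes dir side n []       = refl
length-kindCodes dir side n (c ∷ cs) = begin
  length (cells ++ kindCodes dir side n cs)         ≡⟨ length-++ cells ⟩
  length cells + length (kindCodes dir side n cs)   ≡⟨ cong₂ _+_
    (trans (length-map _ (upTo (n / step c))) (length-upTo (n / step c))) (length-kindCodes dir side n cs) ⟩
  n / step c + blocks n cs                          ∎
  where
  open ≡-Reasoning
  cells : List Code
  cells = map (λ b → dir , side , c , b) (upTo (n / step c))

∈-kindCodes : ∀ dir side n {cs c b} → c ∈ cs → b < n / step c →
                (dir , side , c , b) ∈ kindCodes dir side n cs
∈-kindCodes dir side n c∈cs b<n/s =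
  ∈-concatMap⁺ _ (Any.map (λ { refl → ∈-map⁺ _ (∈-upTo⁺ b<n/s) }) c∈cs)

codesOf : Direction → Side → ℕ → List Code
codesOf dir side n = kindCodes dir side n (classes dir side n)

codes : ℕ → List Code
codes n = codesOf leftward ending n ++ codesOf leftward starting n
       ++ codesOf rightward starting n ++ codesOf rightward ending n

codesOf⊆codes : ∀ dir side n {z} → z ∈ codesOf dir side n → z ∈ codes n
codesOf⊆codes leftward  ending   n z∈ = ∈-++⁺ˡ z∈
codesOf⊆codes leftward  starting n z∈ = ∈-++⁺ʳ (codesOf leftward ending n) (∈-++⁺ˡ z∈)
codesOf⊆codes rightward starting n z∈ = ∈-++⁺ʳ (codesOf leftward ending n)
  (∈-++⁺ʳ (codesOf leftward starting n) (∈-++⁺ˡ z∈))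
codesOf⊆codes rightward ending   n z∈ = ∈-++⁺ʳ (codesOf leftward ending n)
  (∈-++⁺ʳ (codesOf leftward starting n) (∈-++⁺ʳ (codesOf rightward starting n) z∈))

-- Two kinds have the unit class with its `n` blocks, and all four have the main classes: 12 * 2 + 4
-- * 41 = 188.
length-codes : ∀ n → 12 * length (codes n) ≤ 188 * n
length-codes n = subst (λ l → 12 * l ≤ 188 * n) (sym length≡)
  (bound (blocks n (mainClasses n)) (blocks-mainClasses n))
  where
  B : ℕ
  B = blocks n (mainClasses n)

  length≡ : length (codes n) ≡ n + B + (B + (n + B + B))
  length≡ = begin
    length (codes n)
      ≡⟨ length-++ (codesOf leftward ending n) ⟩
    length (codesOf leftward ending n) +
    length (codesOf leftward starting n ++ codesOf rightward starting n ++ codesOf rightward ending n)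
      ≡⟨ cong₂ _+_ with-unit (length-++ (codesOf leftward starting n)) ⟩
    n + B + (length (codesOf leftward starting n) +
      length (codesOf rightward starting n ++ codesOf rightward ending n))
      ≡⟨ cong (n + B +_) (cong₂ _+_
          (length-kindCodes leftward starting n (mainClasses n)) (length-++ (codesOf rightward starting n))) ⟩
    n + B + (B + (length (codesOf rightward starting n) + length (codesOf rightward ending n)))
      ≡⟨ cong (λ l → n + B + (B + l)) (cong₂ _+_ with-unit
          (length-kindCodes rightward ending n (mainClasses n))) ⟩
    n + B + (B + (n + B + B)) ∎
    where
    open ≡-Reasoning
    with-unit : ∀ {dir side} → length (kindCodes dir side n (unitClass ∷ mainClasses n)) ≡ n + B
    with-unit {dir} {side} =
      trans (length-kindCodes dir side n (unitClass ∷ mainClasses n)) (cong (_+ B) (n/1≡n n))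

  bound : ∀ b → 12 * b ≤ 41 * n → 12 * (n + b + (b + (n + b + b))) ≤ 188 * n
  bound b b≤ = ≤-by 0 (*-monoʳ-≤ 4 b≤) (identity b n)
    where
    identity : ∀ b n → 4 * (41 * n) + 12 * (n + b + (b + (n + b + b))) + 0 ≡ 4 * (12 * b) + 188 * n
    identity = solve-∀

-- The shift is not recorded in the code: `event-separation` recovers it together with the gap, and
-- the letter follows.
Encodes : (ℕ → A) → ℕ → Code → ℕ → A → Set
Encodes w n (dir , side , c , b) g x = Sound c × b ≡ block dir (step c) g × ∃ λ q →
  q ∈ᶜ c × Event dir side w n q g × x ≡ letter dir side w q g

Bounded⇒q≤n : ∀ dir {n q g} → Bounded dir n q g → q ≤ n
Bounded⇒q≤n leftward  (q≤g , g≤n) = ≤-trans q≤g g≤n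
Bounded⇒q≤n rightward {g = g} g+q≤n = m+n≤o⇒n≤o g g+q≤n

encode : ∀ {w : ℕ → A} {n g x} → Forbids w n g x → ∃ λ z → z ∈ codes n × Encodes w n z g x
encode {n = n} {g} (dir , side , q , least≤q , event@(bounded , _) , x≡)
  with c , c∈ , q∈c ← classes-cover dir side n least≤q
         (≤-<-trans (Bounded⇒q≤n dir bounded) (m<m+n n z<s))
  with sound-c@(s≤lo , _) ← All.lookup (classes-sound dir side n) c∈ =
  (dir , side , c , block dir (step c) g) ,
  codesOf⊆codes dir side n (∈-kindCodes dir side n c∈
    (block-< dir (step c) (≤-trans s≤lo (proj₁ q∈c)) bounded)) ,
  sound-c , refl , q , q∈c , event , x≡

encodes-injective : ∀ {w : ℕ → A} {n} → ¬ HasSquare w n → ∀ z {g g′ x x′} →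
                    Encodes w n z g x → Encodes w n z g′ x′ → g ≡ g′ × x ≡ x′
encodes-injective ¬square (dir , side , c , b)
  (sound-c , b≡ , q , q∈c , event , x≡) (_ , b≡′ , q′ , q′∈c , event′ , x≡′)
  with refl , refl ← event-separation ¬square dir side {c} sound-c q∈c q′∈c event event′ (trans (sym b≡) b≡′)
  = refl , trans x≡ (sym x≡′)

-- Pigeonhole: pairs of a gap and a letter, numbered by `Fin (suc n * k)`, go injectively to the
-- positions of their codes in the list.
all-forbidden⇒≤ : ∀ {k n} {w : ℕ → Fin k} → ¬ HasSquare w n →
                  (∀ (g : Fin (suc n)) x → Forbids w n (toℕ g) x) → suc n * k ≤ length (codes n)
all-forbidden⇒≤ {k} {n} {w} ¬square forbidden = injective⇒≤ {f = code} code-injective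
  where
  gap : Fin (suc n * k) → Fin (suc n) × Fin k
  gap = remQuot {suc n} k

  encoding : ∀ i → ∃ λ z → z ∈ codes n × Encodes w n z (toℕ (proj₁ (gap i))) (proj₂ (gap i))
  encoding i = encode (forbidden (proj₁ (gap i)) (proj₂ (gap i)))

  code : Fin (suc n * k) → Fin (length (codes n))
  code i = index (proj₁ (proj₂ (encoding i)))

  code-injective : ∀ {i j} → code i ≡ code j → i ≡ j
  code-injective {i} {j} eq = begin
    i                         ≡⟨ combine-remQuot {suc n} k i ⟨
    uncurry combine (gap i)   ≡⟨ cong₂ combine (toℕ-injective (proj₁ same)) (proj₂ same) ⟩
    uncurry combine (gap j)   ≡⟨ combine-remQuot {suc n} k j ⟩
    j                         ∎
    where
    open ≡-Reasoning
    z≡ : proj₁ (encoding i) ≡ proj₁ (encoding j)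
    z≡ = index-injective (setoid Code) (proj₁ (proj₂ (encoding i))) (proj₁ (proj₂ (encoding j))) eq

    same : toℕ (proj₁ (gap i)) ≡ toℕ (proj₁ (gap j)) × proj₂ (gap i) ≡ proj₂ (gap j)
    same = encodes-injective ¬square (proj₁ (encoding i)) (proj₂ (proj₂ (encoding i)))
      (subst (λ z → Encodes w n z _ _) (sym z≡) (proj₂ (proj₂ (encoding j))))

-- 12 * 17 = 204 exceeds 188, and counting `suc n` gaps keeps the inequality strict for the empty
-- word.
crowded-⊥ : ∀ {k n l} → 17 ≤ k → suc n * k ≤ l → 12 * l ≤ 188 * n → ⊥
crowded-⊥ {k} {n} {l} 17≤k nk≤l l≤ = <⇒≱ 188n<204+204n (begin
  204 + 204 * n       ≡⟨ *-distribˡ-+ 204 1 n ⟨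
  204 * suc n         ≡⟨ *-assoc 12 17 (suc n) ⟩
  12 * (17 * suc n)   ≡⟨ cong (12 *_) (*-comm 17 (suc n)) ⟩
  12 * (suc n * 17)   ≤⟨ *-monoʳ-≤ 12 (*-monoʳ-≤ (suc n) 17≤k) ⟩
  12 * (suc n * k)    ≤⟨ *-monoʳ-≤ 12 nk≤l ⟩
  12 * l              ≤⟨ l≤ ⟩
  188 * n             ∎)
  where
  open ≤-Reasoning
  188n<204+204n : 188 * n < 204 + 204 * n
  188n<204+204n = s≤s (≤-trans (*-monoˡ-≤ n (≤ᵇ⇒≤ 188 204 _)) (m≤n+m (204 * n) 203))

theorem1p3 : (k : ℕ) → 17 ≤ k → (W : List (Fin k)) → SquareFree W →
    Σ (List (Fin k)) λ W₁ → Σ (List (Fin k)) λ W₂ → Σ (Fin k) λ x →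
    (W ≡ W₁ ++ W₂) × SquareFree (W₁ ++ x ∷ W₂)
theorem1p3 k 17≤k W squareFree = conclude
  (any? λ g → any? λ x → ¬? (hasSquare? _≟ᶠ_ (ins (toℕ g) x w) (suc n)))
  where
  d : Fin k
  d = fromℕ< (≤-trans (s≤s z≤n) 17≤k)

  w : ℕ → Fin k
  w = at d W

  n : ℕ
  n = length W

  ¬square : ¬ HasSquare w n
  ¬square = squareFree⇒¬hasSquare d W squareFree

  conclude : Dec (∃₂ λ (g : Fin (suc n)) x → ¬ HasSquare (ins (toℕ g) x w) (suc n)) → _
  conclude (yes (g , x , ¬square′)) =
    take (toℕ g) W , drop (toℕ g) W , x , sym (take++drop≡id (toℕ g) W) ,
    ¬hasSquare⇒squareFree d _ λ square → ¬square′
      (HasSquare-cong (λ t → sym (at-insert d (toℕ g) x W t (toℕ≤pred[n] g)))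
        (subst (HasSquare (at d (take (toℕ g) W ++ x ∷ drop (toℕ g) W)))
          (length-insert (toℕ g) x W) square))
  conclude (no none) = ⊥-elim (crowded-⊥ {n = n} 17≤k
    (all-forbidden⇒≤ ¬square λ g x → forbids ¬square (toℕ≤pred[n] g)
      -- Decidability turns the double negation into an actual square.
      (decidable-stable (hasSquare? _≟ᶠ_ (ins (toℕ g) x w) (suc n))
        λ ¬square′ → none (g , x , ¬square′)))
    (length-codes n))
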